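{- Let $p\geq 3$ and $k\geq 1$ be integers. Let $\mathcal{G}$ be the class of $K_p$-free graphs of treedepth at most $k$. Then the defective chromatic number of $\mathcal{G}$, the clustered chromatic number of $\mathcal{G}$, and the chromatic number of $\mathcal{G}$ are equal.
   Context: Graphs are finite, simple and undirected. A graph is $K_p$-free if it has no subgraph isomorphic to the complete graph $K_p$. A $k$-colouring of a graph assigns one of at most $k$ colours to each vertex (not necessarily properly). A monochromatic component is a connected component of the subgraph induced by all vertices of a single colour. A colouring has defect $d$ if every monochromatic component has maximum degree at most $d$, and has clustering $c$ if every monochromatic component has at most $c$ vertices. For a graph class $\mathcal{G}$: the chromatic number of $\mathcal{G}$ is $\max\{\chi(G):G\in\mathcal{G}\}$, where $\chi(G)$ is the usual (proper) chromatic number; the defective chromatic number of $\mathcal{G}$ is the minimum integer $k$ for which there exists an integer $d$ such that every graph in $\mathcal{G}$ is $k$-colourable with defect $d$; the clustered chromatic number of $\mathcal{G}$ is the minimum integer $k$ for which there exists an integer $c$ such that every graph in $\mathcal{G}$ is $k$-colourable with clustering $c$. (Each is called unbounded if the relevant maximum or minimum does not exist.) In a rooted tree, the depth of a vertex $v$ is the number of vertices on the path from the root to $v$; the depth of a rooted forest is the maximum depth of its vertices; the closure of a rooted forest $F$ is the graph on $V(F)$ in which two distinct vertices are adjacent if and only if one is an ancestor of the other. The treedepth of a graph $G$ is the minimum depth of a rooted forest $F$ such that $G$ is a spanning subgraph of the closure of $F$. -}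

module Defs where

open import Data.Fin using (Fin; _≟_)
open import Data.Fin.Subset using (Subset; _∈_; _⊆_; _∩_; ∣_∣; Nonempty)
open import Data.List using (List; []; _∷_; length; map; allFin)
open import Data.List.Extrema.Nat using (max)
import Data.List.Membership.DecPropositional as DecMembership
open import Data.Maybe using (Maybe; just; nothing)
open import Data.Nat using (ℕ; _≤_)
open import Data.Product using (Σ-syntax; ∃-syntax; _×_; _,_)
open import Data.Sum using (_⊎_; swap)
open import Data.Vec using (tabulate)
open import Function using (_∘_; _⇔_; Injective)
open import Level using (Level; 0ℓ; _⊔_) renaming (suc to lsuc)
open import Relation.Binary using (Rel; Symmetric; Irreflexive; Decidable; _⇒_)
open import Relation.Binary.Construct.Closure.ReflexiveTransitive using (Star)
open import Relation.Binary.PropositionalEquality using (_≡_; _≢_; sym)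
open import Relation.Nullary using (¬_; does; ¬?; _×-dec_; _⊎-dec_)

private
  variable
    ℓ : Level
    n : ℕ

IsMinimum : (ℕ → Set ℓ) → ℕ → Set ℓ
IsMinimum P m = P m × (∀ j → P j → m ≤ j)

IsMaximum : (ℕ → Set ℓ) → ℕ → Set ℓ
IsMaximum P m = P m × (∀ j → P j → j ≤ m)

------------------------------------------------------------------------
-- Finite simple graphs

record Graph : Set₁ where
  field
    order      : ℕ
    Adj        : Rel (Fin order) 0ℓ
    adj?       : Decidable Adj
    adj-sym    : Symmetric Adj
    adj-irrefl : Irreflexive _≡_ Adj

  Vertex : Set
  Vertex = Fin order

  neighbours : Vertex → Subset order
  neighbours v = tabulate (does ∘ adj? v)

  Induced : Subset order → Rel Vertex 0ℓ
  Induced S u v = u ∈ S × v ∈ S × Adj u v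

  -- C is the vertex set of a connected component of the subgraph induced by S.
  IsComponent : Subset order → Subset order → Set
  IsComponent S C =
    Nonempty C × C ⊆ S × (∀ {u} → u ∈ C → ∀ v → v ∈ C ⇔ Star (Induced S) u v)

open Graph

GraphClass : (ℓ : Level) → Set (lsuc 0ℓ ⊔ lsuc ℓ)
GraphClass ℓ = Graph → Set ℓ

complete : ℕ → Graph
complete p = record
  { order      = p
  ; Adj        = _≢_
  ; adj?       = λ u v → ¬? (u ≟ v)
  ; adj-sym    = λ u≢v v≡u → u≢v (sym v≡u)
  ; adj-irrefl = λ u≡v u≢v → u≢v u≡v
  }

-- G has a (not necessarily induced) subgraph isomorphic to H.
ContainsCopyOf : Graph → Graph → Set
ContainsCopyOf H G =
  Σ[ f ∈ (Vertex H → Vertex G) ]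
    Injective _≡_ _≡_ f × (∀ {u v} → Adj H u v → Adj G (f u) (f v))

CompleteFree : ℕ → GraphClass 0ℓ
CompleteFree p G = ¬ ContainsCopyOf (complete p) G

------------------------------------------------------------------------
-- Colourings

Colouring : Graph → ℕ → Set
Colouring G k = Vertex G → Fin k

module _ (G : Graph) {k : ℕ} (col : Colouring G k) where

  IsProper : Set
  IsProper = ∀ {u v} → Adj G u v → col u ≢ col v

  colourClass : Fin k → Subset (order G)
  colourClass i = tabulate (λ v → does (col v ≟ i))

  IsMonochromaticComponent : Subset (order G) → Set
  IsMonochromaticComponent C = ∃[ i ] IsComponent G (colourClass i) C

  HasDefect : ℕ → Set
  HasDefect d = ∀ C → IsMonochromaticComponent C →
    ∀ v → v ∈ C → ∣ neighbours G v ∩ C ∣ ≤ d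

  HasClustering : ℕ → Set
  HasClustering c = ∀ C → IsMonochromaticComponent C → ∣ C ∣ ≤ c

IsChromaticNumberOf : Graph → ℕ → Set
IsChromaticNumberOf G = IsMinimum λ k → Σ[ col ∈ Colouring G k ] IsProper G col

IsChromaticNumber : GraphClass ℓ → ℕ → Set (lsuc 0ℓ ⊔ ℓ)
IsChromaticNumber 𝒢 = IsMaximum λ m → ∃[ G ] 𝒢 G × IsChromaticNumberOf G m

IsDefectiveChromaticNumber : GraphClass ℓ → ℕ → Set (lsuc 0ℓ ⊔ ℓ)
IsDefectiveChromaticNumber 𝒢 = IsMinimum λ k →
  ∃[ d ] (∀ G → 𝒢 G → Σ[ col ∈ Colouring G k ] HasDefect G col d)

IsClusteredChromaticNumber : GraphClass ℓ → ℕ → Set (lsuc 0ℓ ⊔ ℓ)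
IsClusteredChromaticNumber 𝒢 = IsMinimum λ k →
  ∃[ c ] (∀ G → 𝒢 G → Σ[ col ∈ Colouring G k ] HasClustering G col c)

------------------------------------------------------------------------
-- Rooted forests and treedepth

-- The path from v up to a root, the roots being the vertices without a parent.
data RootPath (parent : Fin n → Maybe (Fin n)) (v : Fin n) : Set where
  root : parent v ≡ nothing → RootPath parent v
  step : ∀ {u} → parent v ≡ just u → RootPath parent u → RootPath parent v

pathVertices : ∀ {parent : Fin n → Maybe (Fin n)} {v} → RootPath parent v → List (Fin n)
pathVertices {v = v} (root _)   = v ∷ []
pathVertices {v = v} (step _ π) = v ∷ pathVertices π

-- Every vertex reaching a root rules out cycles of parents.
record RootedForest (n : ℕ) : Set where
  field
    parent : Fin n → Maybe (Fin n)
    rooted : ∀ v → RootPath parent v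

  rootPath : Fin n → List (Fin n)
  rootPath v = pathVertices (rooted v)

  vertexDepth : Fin n → ℕ
  vertexDepth v = length (rootPath v)

  depth : ℕ
  depth = max 0 (map vertexDepth (allFin n))

  open DecMembership (_≟_ {n}) using () renaming (_∈_ to _∈ˡ_; _∈?_ to _∈ˡ?_)

  -- Reflexive: a vertex lies on its own path to the root.
  Ancestor : Rel (Fin n) 0ℓ
  Ancestor u v = u ∈ˡ rootPath v

  closure : Graph
  closure = record
    { order      = n
    ; Adj        = λ u v → u ≢ v × (Ancestor u v ⊎ Ancestor v u)
    ; adj?       = λ u v → ¬? (u ≟ v) ×-dec ((u ∈ˡ? rootPath v) ⊎-dec (v ∈ˡ? rootPath u))
    ; adj-sym    = λ (u≢v , a) → (λ v≡u → u≢v (sym v≡u)) , swap a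
    ; adj-irrefl = λ u≡v (u≢v , _) → u≢v u≡v
    }

open RootedForest

IsTreedepth : Graph → ℕ → Set
IsTreedepth G = IsMinimum λ m →
  Σ[ F ∈ RootedForest (order G) ] Adj G ⇒ Adj (closure F) × depth F ≡ m

TreedepthAtMost : ℕ → GraphClass 0ℓ
TreedepthAtMost k G = ∃[ t ] IsTreedepth G t × t ≤ k

CompleteFreeOfTreedepthAtMost : ℕ → ℕ → GraphClass 0ℓ
CompleteFreeOfTreedepthAtMost p k G = CompleteFree p G × TreedepthAtMost k G

{-# OPTIONS --safe #-}
module Submission where

-- Fix p and k = h + 1. There is a universal graph U in the class: its vertices are the nodes of a rooted tree that
-- enumerates, along each branch, all ways of attaching a new vertex to its ancestors so that the branch stays K_p-free.
-- Every graph of the class is mapped to U by sending a vertex to the adjacency pattern of its path to the root, so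
-- n = χ(U) colours suffice properly. Conversely, replicate every node of U more than h d times: a colouring of the
-- resulting graph with defect d yields a proper colouring of U, since the copies can be picked greedily from the root
-- down so as to avoid the colours of the neighbours among the ancestors.

open import Defs
open import Data.Bool using (Bool; true; false)
import Data.Bool.Properties as Bool
open import Data.Empty using (⊥)
open import Data.Fin using (Fin; zero; suc; finToFun; funToFin; _≟_)
open import Data.Fin.Properties using (any?; all?; sequence; finToFun-funToFin)
open import Data.Fin.Subset as Subset using (Subset; ∣_∣; _-_; _∩_; ⁅_⁆)
open import Data.Fin.Subset.Properties
  using ( Empty-unique; ∣⊥∣≡0; x∈⁅x⁆; ∣⁅x⁆∣≡1; p⊆q⇒∣p∣≤∣q∣; ∣p∩q∣≤∣q∣
        ; x∈p∩q⁺; x∈p∩q⁻; x∈p∧x≢y⇒x∈p-y; x∈p⇒∣p-x∣<∣p∣ )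
open import Data.List
  using ( List; []; _∷_; length; map; allFin; filter; lookup; tails
        ; cartesianProduct; cartesianProductWith )
import Data.List.Extrema.Nat as Extrema
import Data.List.Membership.DecPropositional as DecMembership
open import Data.List.Membership.Propositional using (_∈_)
open import Data.List.Membership.Propositional.Properties
  using ( ∈-lookup; ∈-allFin; ∈-map⁺; ∈-filter⁻; ∈-cartesianProductWith⁺
        ; ∈-cartesianProductWith⁻; ∈-cartesianProduct⁺; ∈-cartesianProduct⁻ )
open import Data.List.Properties using (≡-dec; length-map; length-tabulate; ∷-injective; ∷-injectiveˡ)
open import Data.List.Relation.Unary.All as All using (All; []; _∷_)
import Data.List.Relation.Unary.All.Properties as All
open import Data.List.Relation.Unary.AllPairs using ([]; _∷_)
open import Data.List.Relation.Unary.Any using (here; there; index)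
open import Data.List.Relation.Unary.Any.Properties using (lookup-index)
open import Data.List.Relation.Unary.Unique.Propositional using (Unique)
import Data.List.Relation.Unary.Unique.Propositional.Properties as Unique
open import Data.Maybe using (Maybe; just; nothing)
open import Data.Maybe.Properties using (just-injective)
open import Data.Nat using (ℕ; zero; suc; _+_; _*_; _≤_; _<_; z≤n; s≤s; _≤?_)
open import Data.Nat.Induction using (<-rec)
open import Data.Nat.Properties
  using ( ≤-refl; ≤-reflexive; ≤-trans; ≤-antisym; <⇒≤; <⇒≱; ≮⇒≥; <-irrefl; 1+n≰n; m≤n⇒m≤1+n
        ; +-suc; +-cancelˡ-<; +-monoˡ-≤; *-monoˡ-≤; anyUpTo?; module ≤-Reasoning )
open import Data.Product using (∃; Σ-syntax; ∃-syntax; _×_; _,_; proj₁; proj₂)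
import Data.Product.Properties as Product
open import Data.Sum as Sum using (_⊎_; inj₁; inj₂; swap; [_,_]′)
import Data.Vec as Vec
open import Data.Vec.Properties using (lookup∘tabulate; lookup⇒[]=; []=⇒lookup)
open import Effect.Monad using (RawMonad)
open import Function using (_∘_; id; Equivalence; _⇔_; mk⇔)
open import Level using (0ℓ)
open import Relation.Binary using (_⇒_; DecidableEquality)
open import Relation.Binary.Construct.Closure.ReflexiveTransitive as Star using (Star; ε; _◅_; _◅◅_)
open import Relation.Binary.PropositionalEquality
open import Relation.Binary.PropositionalEquality.WithK using (≡-irrelevant)
open import Relation.Nullary using (¬_; Dec; yes; no; does; ¬?; contradiction; _×-dec_; _→-dec_; _⊎-dec_)
open import Relation.Nullary.Decidable using (map′; dec-true; decidable-stable; ¬¬-excluded-middle)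
open import Relation.Nullary.Negation using (¬¬-Monad)
open import Relation.Unary using (Pred; Decidable)

open Graph
open RootedForest

-- Finite search and counting

least : ∀ {ℓ} {P : ℕ → Set ℓ} → Decidable P → ∀ {m} → P m → ∃[ n ] IsMinimum P n
least {P = P} P? {m} = <-rec (λ m → P m → ∃[ n ] IsMinimum P n) search m
  where
  search : ∀ m → (∀ {j} → j < m → P j → ∃[ n ] IsMinimum P n) → P m → ∃[ n ] IsMinimum P n
  search m smaller Pm with anyUpTo? P? m
  ... | yes (_ , j<m , Pj) = smaller j<m Pj
  ... | no none = m , Pm , λ j Pj → ≮⇒≥ λ j<m → none (j , j<m , Pj)

-- Functions are enumerated through `finToFun`, which recovers a given function only up to pointwise
-- equality; hence `P` has to respect `≗`.
any-function? : ∀ {m n} {P : (Fin m → Fin n) → Set} →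
  (∀ {f g} → f ≗ g → P f → P g) → Decidable P → Dec (∃ P)
any-function? resp P? = map′
  (λ (i , Pi) → finToFun i , Pi)
  (λ (f , Pf) → funToFin f , resp (λ x → sym (finToFun-funToFin f x)) Pf)
  (any? (P? ∘ finToFun))

length-filter-¬ : ∀ {A : Set} {P : Pred A 0ℓ} (P? : Decidable P) xs →
  length (filter P? xs) + length (filter (¬? ∘ P?) xs) ≡ length xs
length-filter-¬ P? [] = refl
length-filter-¬ P? (x ∷ xs) with P? x
... | yes _ = cong suc (length-filter-¬ P? xs)
... | no _ = trans (+-suc (length (filter P? xs)) _) (cong suc (length-filter-¬ P? xs))

-- Greedy selection: each `a` spoils at most `d` candidates, so discarding those bad for the head
-- leaves enough for the rest. As `few` speaks of arbitrary duplicate-free lists, it still applies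
-- after filtering.
avoid : ∀ {A B : Set} {Bad : A → B → Set} (bad? : ∀ a b → Dec (Bad a b)) {d} as →
  (∀ {a} → a ∈ as → ∀ {bs} → Unique bs → All (Bad a) bs → length bs ≤ d) →
  ∀ {bs} → Unique bs → length as * d < length bs →
  ∃[ b ] b ∈ bs × All (λ a → ¬ Bad a b) as
avoid bad? [] few {b ∷ _} _ _ = b , here refl , []
avoid {Bad = Bad} bad? {d} (a ∷ as) few {bs} unique large =
  let b , b∈ , good = avoid bad? as (few ∘ there) (Unique.filter⁺ (¬? ∘ bad? a) unique) large′
      b∈bs , ¬bad = ∈-filter⁻ (¬? ∘ bad? a) b∈
  in b , b∈bs , ¬bad ∷ good
  where
  open ≤-Reasoning
  large′ : length as * d < length (filter (¬? ∘ bad? a) bs)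
  large′ = +-cancelˡ-< d _ _ (begin-strict
    d + length as * d                  <⟨ large ⟩
    length bs                          ≡⟨ length-filter-¬ (bad? a) bs ⟨
    length (filter (bad? a) bs) + _    ≤⟨ +-monoˡ-≤ _ (few (here refl)
                                            (Unique.filter⁺ (bad? a) unique) (All.all-filter (bad? a) bs)) ⟩
    d + _                              ∎)

length≤∣_∣ : ∀ {n} (S : Subset n) {xs} → Unique xs → All (Subset._∈ S) xs → length xs ≤ ∣ S ∣
length≤∣ S ∣ [] [] = z≤n
length≤∣ S ∣ {x ∷ xs} (x∉xs ∷ unique) (x∈S ∷ xs⊆S) = ≤-trans
  (s≤s (length≤∣ S - x ∣ unique
    (All.zipWith (λ (x≢y , y∈S) → x∈p∧x≢y⇒x∈p-y y∈S (≢-sym x≢y)) (x∉xs , xs⊆S))))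
  (x∈p⇒∣p-x∣<∣p∣ x∈S)

module _ {n : ℕ} {f : Fin n → Bool} where

  ∈-tabulate⁺ : ∀ {x} → f x ≡ true → x Subset.∈ Vec.tabulate f
  ∈-tabulate⁺ {x} fx = lookup⇒[]= x _ (trans (lookup∘tabulate f x) fx)

  ∈-tabulate⁻ : ∀ {x} → x Subset.∈ Vec.tabulate f → f x ≡ true
  ∈-tabulate⁻ {x} x∈ = trans (sym (lookup∘tabulate f x)) ([]=⇒lookup x∈)

does⁻ : ∀ {A : Set} (a? : Dec A) → does a? ≡ true → A
does⁻ (yes a) _ = a

-- Colourings

module _ (G : Graph) where

  ProperlyColourable : ℕ → Set
  ProperlyColourable k = Σ[ col ∈ Colouring G k ] IsProper G col

  properlyColourable? : Decidable ProperlyColourable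
  properlyColourable? k = any-function?
    (λ f≗g proper {u} {v} uv → subst₂ _≢_ (f≗g u) (f≗g v) (proper uv))
    (λ col → map′ (λ proper {u} {v} → proper u v) (λ proper u v → proper)
      (all? λ u → all? λ v → adj? G u v →-dec ¬? (col u ≟ col v)))

  hasChromaticNumber : ∃[ n ] IsChromaticNumberOf G n
  hasChromaticNumber = least properlyColourable?
    -- Giving every vertex its own colour is proper, so the search has a starting point.
    {order G} (id , λ uv u≡v → adj-irrefl G u≡v uv)

module _ (G : Graph) {k : ℕ} (col : Colouring G k) where

  ∈-colourClass⁺ : ∀ {i v} → col v ≡ i → v Subset.∈ colourClass G col i
  ∈-colourClass⁺ {i} {v} eq = ∈-tabulate⁺ (dec-true (col v ≟ i) eq)

  ∈-colourClass⁻ : ∀ {i v} → v Subset.∈ colourClass G col i → col v ≡ i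
  ∈-colourClass⁻ {i} {v} v∈ = does⁻ (col v ≟ i) (∈-tabulate⁻ v∈)

  ¬monochromaticEdge : IsProper G col → ∀ {i u v} → ¬ Induced G (colourClass G col i) u v
  ¬monochromaticEdge proper (u∈ , v∈ , uv) =
    proper uv (trans (∈-colourClass⁻ u∈) (sym (∈-colourClass⁻ v∈)))

  proper⇒defect0 : IsProper G col → HasDefect G col 0
  proper⇒defect0 proper C (i , _ , C⊆S , _) v v∈C =
    ≤-reflexive (trans (cong ∣_∣ (Empty-unique λ (w , w∈) →
      let w∈N , w∈C = x∈p∩q⁻ (neighbours G v) C w∈
      in ¬monochromaticEdge proper (C⊆S v∈C , C⊆S w∈C , does⁻ (adj? G v w) (∈-tabulate⁻ w∈N))))
    (∣⊥∣≡0 (order G)))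

  proper⇒clustering1 : IsProper G col → HasClustering G col 1
  proper⇒clustering1 proper C (i , (u , u∈C) , C⊆S , connected) =
    ≤-trans (p⊆q⇒∣p∣≤∣q∣ C⊆u) (≤-reflexive (∣⁅x⁆∣≡1 u))
    where
    C⊆u : C Subset.⊆ ⁅ u ⁆
    C⊆u {v} v∈C with Equivalence.to (connected u∈C v) v∈C
    ... | ε = x∈⁅x⁆ u
    ... | uw ◅ _ = contradiction uw (¬monochromaticEdge proper)

  clustering⇒defect : ∀ {c} → HasClustering G col c → HasDefect G col c
  clustering⇒defect clustering C component v _ =
    ≤-trans (∣p∩q∣≤∣q∣ (neighbours G v) C) (clustering C component)

  -- Reachability is only needed up to double negation, because the conclusion is decidable.
  defect⇒few : ∀ {d} → HasDefect G col d → ∀ {u vs} → Unique vs →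
    All (λ v → Adj G u v × col v ≡ col u) vs → length vs ≤ d
  defect⇒few {d} defect {u} {vs} unique mono = decidable-stable (_ ≤? _) do
    reach? ← sequence (RawMonad.rawApplicative ¬¬-Monad) (λ v → ¬¬-excluded-middle {A = Star E u v})
    pure (few reach?)
    where
    open RawMonad (¬¬-Monad {0ℓ})
    S = colourClass G col (col u)
    E = Induced G S
    few : (∀ v → Dec (Star E u v)) → length vs ≤ d
    few reach? = ≤-trans
      (length≤∣ neighbours G u ∩ C ∣ unique (All.map (λ {v} (uv , same) → x∈p∩q⁺
        (∈-tabulate⁺ (dec-true (adj? G u v) uv) ,
         ∈C⁺ ((∈-colourClass⁺ refl , ∈-colourClass⁺ same , uv) ◅ ε))) mono))
      (defect C (col u , (u , ∈C⁺ ε) , (λ v∈C → C⊆S (∈C⁻ v∈C)) , connected) u (∈C⁺ ε))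
      where
      -- The monochromatic component of `u`: all of `vs` are neighbours of `u` inside it, so the
      -- defect at `u` bounds their number.
      C = Vec.tabulate (does ∘ reach?)
      ∈C⁺ : ∀ {v} → Star E u v → v Subset.∈ C
      ∈C⁺ {v} r = ∈-tabulate⁺ (dec-true (reach? v) r)
      ∈C⁻ : ∀ {v} → v Subset.∈ C → Star E u v
      ∈C⁻ {v} v∈ = does⁻ (reach? v) (∈-tabulate⁻ v∈)
      E-sym : ∀ {v w} → E v w → E w v
      E-sym (v∈ , w∈ , vw) = w∈ , v∈ , adj-sym G vw
      C⊆S : ∀ {v} → Star E u v → v Subset.∈ S
      C⊆S r = Star.fold (λ v w → v Subset.∈ S → w Subset.∈ S) (λ (_ , w∈ , _) k _ → k w∈) id r (∈-colourClass⁺ refl)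
      connected : ∀ {v} → v Subset.∈ C → ∀ w → w Subset.∈ C ⇔ Star E v w
      connected v∈ w = mk⇔ (λ w∈ → Star.reverse E-sym (∈C⁻ v∈) ◅◅ ∈C⁻ w∈) (λ r → ∈C⁺ (∈C⁻ v∈ ◅◅ r))

-- Treedepth

-- Every step is forced by `parent`. Thus a path met as a tail of a longer path agrees with the one
-- stored in the forest.
RootPath-irrelevant : ∀ {n} {parent : Fin n → Maybe (Fin n)} {v} (π π′ : RootPath parent v) → π ≡ π′
RootPath-irrelevant (root p) (root q) = cong root (≡-irrelevant p q)
RootPath-irrelevant (root p) (step q _) with () ← trans (sym p) q
RootPath-irrelevant (step p _) (root q) with () ← trans (sym q) p
RootPath-irrelevant (step p π) (step q ρ) with refl ← just-injective (trans (sym p) q) =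
  cong₂ step (≡-irrelevant p q) (RootPath-irrelevant π ρ)

RootPath-≗ : ∀ {n} {f g : Fin n → Maybe (Fin n)} → f ≗ g → ∀ {v} (π : RootPath f v) →
  Σ[ π′ ∈ RootPath g v ] pathVertices π′ ≡ pathVertices π
RootPath-≗ f≗g {v} (root p) = root (trans (sym (f≗g v)) p) , refl
RootPath-≗ f≗g {v} (step p π) =
  let π′ , eq = RootPath-≗ f≗g π in step (trans (sym (f≗g v)) p) π′ , cong (v ∷_) eq

rootPath-≗ : ∀ {n} (F F′ : RootedForest n) → parent F ≗ parent F′ → rootPath F ≗ rootPath F′
rootPath-≗ F F′ eq v =
  let π , π≡ = RootPath-≗ eq (rooted F v)
  in trans (sym π≡) (cong pathVertices (RootPath-irrelevant π (rooted F′ v)))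

depth≤⁺ : ∀ {n m} (F : RootedForest n) → (∀ v → vertexDepth F v ≤ m) → depth F ≤ m
depth≤⁺ {n} F bound = Extrema.max≤v⁺ z≤n (All.map⁺ (All.tabulate {xs = allFin n} λ {v} _ → bound v))

vertexDepth≤depth : ∀ {n} (F : RootedForest n) v → vertexDepth F v ≤ depth F
vertexDepth≤depth {n} F v = All.lookup (Extrema.xs≤max 0 (map (vertexDepth F) (allFin n)))
  (∈-map⁺ (vertexDepth F) (∈-allFin v))

module _ {n : ℕ} (parent : Fin n → Maybe (Fin n)) where

  -- The length bound serves as fuel: the search stops even if `parent` has a cycle.
  shortRootPath? : ∀ m v → Dec (Σ[ π ∈ RootPath parent v ] length (pathVertices π) ≤ m)
  shortRootPath? zero v = no λ { (root _ , ()) ; (step _ _ , ()) }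
  shortRootPath? (suc m) v with parent v in eq
  ... | nothing = yes (root eq , s≤s z≤n)
  ... | just u = map′
    (λ (π , short) → step eq π , s≤s short)
    (λ { (root p , _) → contradiction (trans (sym p) eq) λ ()
       ; (step p π , s≤s short) → subst (λ w → Σ[ π ∈ RootPath parent w ] length (pathVertices π) ≤ m)
                                    (just-injective (trans (sym p) eq)) (π , short) })
    (shortRootPath? m u)

module _ (G : Graph) where

  EmbedsInForest : ℕ → Set
  EmbedsInForest m = Σ[ F ∈ RootedForest (order G) ] Adj G ⇒ Adj (closure F) × depth F ≤ m

  private
    Parent : Set
    Parent = Vertex G → Maybe (Vertex G)

    -- Parents determine root paths, so fixing the parent function turns the search for a forest
    -- into one over finitely many functions.
    EmbedsVia : ℕ → Parent → Set
    EmbedsVia m parent′ = Σ[ F ∈ RootedForest (order G) ]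
      parent F ≗ parent′ × Adj G ⇒ Adj (closure F) × (∀ v → vertexDepth F v ≤ m)

    embedsVia? : ∀ m → Decidable (EmbedsVia m)
    embedsVia? m parent′ with all? (shortRootPath? parent′ m)
    ... | no ¬short = no λ (F , eq , _ , short) → ¬short λ v →
      let π , π≡ = RootPath-≗ eq (rooted F v) in π , subst (_≤ m) (sym (cong length π≡)) (short v)
    ... | yes short = map′
      (λ emb → F , (λ _ → refl) , (λ {u} {v} → emb u v) , proj₂ ∘ short)
      (λ (F′ , eq , emb , _) u v uv → subst₂
         (λ p q → u ≢ v × (u ∈ q ⊎ v ∈ p)) (rootPath-≗ F′ F eq u) (rootPath-≗ F′ F eq v) (emb uv))
      (all? λ u → all? λ v → adj? G u v →-dec adj? (closure F) u v)
      where
      F : RootedForest (order G)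
      F = record { parent = parent′ ; rooted = proj₁ ∘ short }

    decode : Fin (suc (order G)) → Maybe (Vertex G)
    decode zero = nothing
    decode (suc u) = just u

    encode : Maybe (Vertex G) → Fin (suc (order G))
    encode nothing = zero
    encode (just u) = suc u

    decode-encode : ∀ x → x ≡ decode (encode x)
    decode-encode nothing = refl
    decode-encode (just _) = refl

  embedsInForest? : Decidable EmbedsInForest
  embedsInForest? m = map′
    (λ (_ , F , _ , emb , short) → F , (λ {u} {v} → emb {u} {v}) , depth≤⁺ F short)
    (λ (F , emb , deep) → encode ∘ parent F , F , decode-encode ∘ parent F , (λ {u} {v} → emb {u} {v}) ,
      λ v → ≤-trans (vertexDepth≤depth F v) deep)
    (any-function? {P = λ f → EmbedsVia m (decode ∘ f)}
      (λ f≗g (F , eq , emb) → F , (λ v → trans (eq v) (cong decode (f≗g v))) , emb)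
      (λ f → embedsVia? m (decode ∘ f)))

  -- `TreedepthAtMost` asks for the exact treedepth, so the least depth bound is searched for;
  -- minimality forces its forest to attain the bound.
  treedepthAtMost : ∀ {m} → EmbedsInForest m → TreedepthAtMost m G
  treedepthAtMost {m} embeds with least embedsInForest? embeds
  ... | t , (F , emb , deep) , minimal =
    t ,
    ((F , (λ {u} {v} → emb {u} {v}) ,
      ≤-antisym deep (minimal (depth F) (F , (λ {u} {v} → emb {u} {v}) , ≤-refl))) ,
     λ j (F′ , emb′ , depth≡j) → minimal j (F′ , (λ {u} {v} → emb′ {u} {v}) , ≤-reflexive depth≡j)) ,
    minimal m embeds

-- Words

module _ {A : Set} where

  words : List A → ℕ → List (List A)
  words xs zero = [] ∷ []
  words xs (suc n) = [] ∷ cartesianProductWith _∷_ xs (words xs n)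

  ∈-words⁺ : ∀ {xs w n} → All (_∈ xs) w → length w ≤ n → w ∈ words xs n
  ∈-words⁺ {n = zero} [] _ = here refl
  ∈-words⁺ {n = suc n} [] _ = here refl
  ∈-words⁺ {n = suc n} (x∈ ∷ w⊆) (s≤s short) = there (∈-cartesianProductWith⁺ _∷_ x∈ (∈-words⁺ w⊆ short))

  ∈-words⁻ : ∀ {xs w} n → w ∈ words xs n → All (_∈ xs) w × length w ≤ n
  ∈-words⁻ zero (here refl) = [] , z≤n
  ∈-words⁻ (suc n) (here refl) = [] , z≤n
  ∈-words⁻ {xs} (suc n) (there w∈) with ∈-cartesianProductWith⁻ _∷_ xs (words xs n) w∈
  ... | x , w , x∈ , w∈′ , refl = let w⊆ , short = ∈-words⁻ n w∈′ in x∈ ∷ w⊆ , s≤s short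

  words-unique : ∀ {xs} → Unique xs → ∀ n → Unique (words xs n)
  words-unique unique zero = [] ∷ []
  words-unique {xs} unique (suc n) =
    All.tabulate (λ w∈ []≡w → nonempty (subst (_∈ _) (sym []≡w) w∈)) ∷
    Unique.cartesianProductWith⁺ _∷_ ∷-injective unique (words-unique unique n)
    where
    nonempty : ¬ [] ∈ cartesianProductWith _∷_ xs (words xs n)
    nonempty []∈ with ∈-cartesianProductWith⁻ _∷_ xs (words xs n) []∈
    ... | _ , _ , _ , _ , ()

  lookup-injective : ∀ {xs : List A} → Unique xs → ∀ {i j} → lookup xs i ≡ lookup xs j → i ≡ j
  lookup-injective (_ ∷ _) {zero} {zero} _ = refl
  lookup-injective {_ ∷ xs} (x≢ ∷ _) {zero} {suc j} eq = contradiction eq (All.lookup x≢ (∈-lookup {xs = xs} j))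
  lookup-injective {_ ∷ xs} (x≢ ∷ _) {suc i} {zero} eq = contradiction (sym eq) (All.lookup x≢ (∈-lookup {xs = xs} i))
  lookup-injective (_ ∷ unique) {suc i} {suc j} eq = cong suc (lookup-injective unique eq)

  ∈-tails⇒length≤ : ∀ {u} (w : List A) → u ∈ tails w → length u ≤ length w
  ∈-tails⇒length≤ w (here refl) = ≤-refl
  ∈-tails⇒length≤ (_ ∷ w) (there u∈) = m≤n⇒m≤1+n (∈-tails⇒length≤ w u∈)

  length-tails : (w : List A) → length (tails w) ≡ suc (length w)
  length-tails [] = refl
  length-tails (_ ∷ w) = cong suc (length-tails w)

-- A word encodes a vertex of a rooted tree together with its ancestors, which are the proper suffixes.
-- The bits of a letter tell which of the suffixes below it (longest first) are adjacent to it,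
-- and the second component distinguishes copies of the same vertex.
Word : ℕ → Set
Word s = List (List Bool × Fin s)

-- Bits and suffixes are read in parallel. Bit lists of any length are allowed: missing bits mean
-- non-adjacency, and surplus bits select nothing.
data Selects {s} : List Bool → Word s → Word s → Set where
  here  : ∀ {b bs w} → b ≡ true → Selects (b ∷ bs) w w
  there : ∀ {b bs x w u} → Selects bs w u → Selects (b ∷ bs) (x ∷ w) u

data Back {s} : Word s → Word s → Set where
  back : ∀ {bs c w u} → Selects bs w u → Back ((bs , c) ∷ w) u

module _ {s : ℕ} where

  _≟ʷ_ : DecidableEquality (Word s)
  _≟ʷ_ = ≡-dec (Product.≡-dec (≡-dec Bool._≟_) _≟_)

  selects? : ∀ bs (w u : Word s) → Dec (Selects bs w u)
  selects? [] w u = no λ ()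
  selects? (b ∷ bs) w u = map′
    (λ { (inj₁ (b≡ , refl)) → here b≡ ; (inj₂ deeper) → deep w deeper })
    (λ { (here b≡) → inj₁ (b≡ , refl) ; (there sel) → inj₂ sel })
    ((b Bool.≟ true ×-dec w ≟ʷ u) ⊎-dec below? w)
    where
    Below : Word s → Set
    Below [] = ⊥
    Below (_ ∷ w) = Selects bs w u
    below? : ∀ w → Dec (Below w)
    below? [] = no λ ()
    below? (_ ∷ w) = selects? bs w u
    deep : ∀ w → Below w → Selects (b ∷ bs) w u
    deep (_ ∷ w) = there

  back? : ∀ (w u : Word s) → Dec (Back w u)
  back? [] u = no λ ()
  back? ((bs , _) ∷ w) u = map′ back (λ { (back sel) → sel }) (selects? bs w u)

  selects⇒∈-tails : ∀ {bs} {w u : Word s} → Selects bs w u → u ∈ tails w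
  selects⇒∈-tails (here _) = here refl
  selects⇒∈-tails (there sel) = there (selects⇒∈-tails sel)

  back⇒∈-tails : ∀ {w u : Word s} → Back w u → u ∈ tails w
  back⇒∈-tails (back sel) = there (selects⇒∈-tails sel)

  back⇒length< : ∀ {w u : Word s} → Back w u → length u < length w
  back⇒length< {_ ∷ w} (back sel) = s≤s (∈-tails⇒length≤ w (selects⇒∈-tails sel))

  Joined : Word s → Word s → Set
  Joined w u = Back w u ⊎ Back u w

  -- The history consists of `w` and its ancestors. Members with different indices are distinct
  -- because joined words differ in length.
  Clique : ℕ → Word s → Set
  Clique p w = Σ[ f ∈ (Fin p → Word s) ] (∀ i → f i ∈ tails w) × (∀ {i j} → i ≢ j → Joined (f i) (f j))

  clique? : ∀ p w → Dec (Clique p w)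
  clique? p w = map′
    (λ (f , joined) → lookup (tails w) ∘ f , (λ i → ∈-lookup {xs = tails w} (f i)) , λ {i} {j} → joined i j)
    (λ (f , f∈ , joined) → index ∘ f∈ , λ i j i≢j →
      subst₂ Joined (lookup-index (f∈ i)) (lookup-index (f∈ j)) (joined i≢j))
    (any-function? {P = λ f → ∀ i j → i ≢ j → Joined (lookup (tails w) (f i)) (lookup (tails w) (f j))}
      (λ f≗g joined i j i≢j →
        subst₂ (λ x y → Joined (lookup (tails w) x) (lookup (tails w) y)) (f≗g i) (f≗g j) (joined i j i≢j))
      (λ f → all? λ i → all? λ j → ¬? (i ≟ j) →-dec (back? _ _ ⊎-dec back? _ _)))

  -- A word whose history contains a clique of size p keeps none of its back edges.
  Arc : ℕ → Word s → Word s → Set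
  Arc p w u = ¬ Clique p w × Back w u

  arc? : ∀ p w u → Dec (Arc p w u)
  arc? p w u = ¬? (clique? p w) ×-dec back? w u

-- Changing the copy indices of a word

module _ {s s′ : ℕ} (choose : List Bool → Word s′ → Fin s′) where

  -- The choice for a letter sees the ancestors already recopied, as a greedy choice from the root
  -- downwards requires.
  recopy : Word s → Word s′
  recopy [] = []
  recopy ((bs , _) ∷ w) = (bs , choose bs (recopy w)) ∷ recopy w

  recopy-selects : ∀ {bs w u} → Selects bs w u → Selects bs (recopy w) (recopy u)
  recopy-selects (here b≡) = here b≡
  recopy-selects (there sel) = there (recopy-selects sel)

  recopy-back : ∀ {w u} → Back w u → Back (recopy w) (recopy u)
  recopy-back (back sel) = back (recopy-selects sel)

  recopy-tails : ∀ w {u} → u ∈ tails w → recopy u ∈ tails (recopy w)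
  recopy-tails w (here refl) = here refl
  recopy-tails (_ ∷ w) (there u∈) = there (recopy-tails w u∈)

  recopy-clique : ∀ {p} w → Clique p w → Clique p (recopy w)
  recopy-clique w (f , f∈ , joined) =
    recopy ∘ f , recopy-tails w ∘ f∈ , λ i≢j → Sum.map recopy-back recopy-back (joined i≢j)

recopy-recopy : ∀ {s} choose choose′ (w : Word 1) → recopy {s} {1} choose′ (recopy {1} {s} choose w) ≡ w
recopy-recopy choose choose′ [] = refl
recopy-recopy choose choose′ ((bs , zero) ∷ w) =
  cong₂ (λ c w → (bs , c) ∷ w) (Fin1 _) (recopy-recopy choose choose′ w)
  where
  Fin1 : (i : Fin 1) → i ≡ zero
  Fin1 zero = refl

-- `Arc` forbids cliques, so these must be reflected by recopying. A clique in the new history is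
-- recopied back to a single copy, which restores the original word.
recopy-arc : ∀ {p s} choose {w u} → Arc p w u → Arc p (recopy {1} {s} choose w) (recopy choose u)
recopy-arc {p} choose {w} (free , b) =
  (λ clique → free (subst (Clique p) (recopy-recopy choose (λ _ _ → zero) w) (recopy-clique _ _ clique))) ,
  recopy-back choose b

-- The universal graph

module Universal (p s h : ℕ) where

  -- The root is the empty word and depth counts vertices, so at most `h` letters means depth at
  -- most `h + 1`. A letter then has at most `h` proper ancestors, one bit for each.
  vertices : List (Word s)
  vertices = words (cartesianProduct (words (true ∷ false ∷ []) h) (allFin s)) h

  Admissible : Word s → Set
  Admissible w = All (λ (bs , _) → length bs ≤ h) w × length w ≤ h

  vertices-unique : Unique vertices
  vertices-unique = words-unique
    (Unique.cartesianProduct⁺ (words-unique (((λ ()) ∷ []) ∷ [] ∷ []) h) (Unique.allFin⁺ s)) h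

  ∈-vertices⁺ : ∀ {w} → Admissible w → w ∈ vertices
  ∈-vertices⁺ (short , len) = ∈-words⁺
    (All.map (λ b≤h → ∈-cartesianProduct⁺ (∈-words⁺ (All.tabulate λ {b} _ → ∈-bools b) b≤h) (∈-allFin _)) short) len
    where
    ∈-bools : ∀ b → b ∈ true ∷ false ∷ []
    ∈-bools true = here refl
    ∈-bools false = there (here refl)

  ∈-vertices⁻ : ∀ {w} → w ∈ vertices → Admissible w
  ∈-vertices⁻ w∈ =
    let w⊆ , len = ∈-words⁻ h w∈
    in All.map (λ x∈ → proj₂ (∈-words⁻ h (proj₁ (∈-cartesianProduct⁻ _ _ x∈)))) w⊆ , len

  label : Fin (length vertices) → Word s
  label = lookup vertices

  label-admissible : ∀ i → Admissible (label i)
  label-admissible i = ∈-vertices⁻ (∈-lookup i)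

  abstract

    -- Inadmissible words are sent to the root.
    vertex : Word s → Fin (length vertices)
    vertex w with DecMembership._∈?_ _≟ʷ_ w vertices
    ... | yes w∈ = index w∈
    ... | no _ = index (∈-vertices⁺ ([] , z≤n))

    label-vertex : ∀ {w} → Admissible w → label (vertex w) ≡ w
    label-vertex {w} adm with DecMembership._∈?_ _≟ʷ_ w vertices
    ... | yes w∈ = sym (lookup-index w∈)
    ... | no w∉ = contradiction (∈-vertices⁺ adm) w∉

  vertex-label : ∀ i → vertex (label i) ≡ i
  vertex-label i = lookup-injective vertices-unique (label-vertex (label-admissible i))

  tail-admissible : ∀ {x w} → Admissible (x ∷ w) → Admissible w
  tail-admissible (_ ∷ short , len) = short , <⇒≤ len

  universal : Graph
  universal = record
    { order = length vertices
    ; Adj = λ i j → Arc p (label i) (label j) ⊎ Arc p (label j) (label i)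
    ; adj? = λ i j → arc? p (label i) (label j) ⊎-dec arc? p (label j) (label i)
    ; adj-sym = swap
    ; adj-irrefl = λ { refl → [ loop , loop ]′ }
    }
    where
    loop : ∀ {w} → ¬ Arc p w w
    loop (_ , b) = <-irrefl refl (back⇒length< b)

  arc⇒adj : ∀ {w u} → Admissible w → Admissible u → Arc p w u → Adj universal (vertex w) (vertex u)
  arc⇒adj w✓ u✓ = inj₁ ∘ subst₂ (Arc p) (sym (label-vertex w✓)) (sym (label-vertex u✓))

  parentOf : Word s → Maybe (Fin (length vertices))
  parentOf [] = nothing
  parentOf (_ ∷ w) = just (vertex w)

  -- The word is carried beside the index that it labels, so that the recursion is structural: the
  -- parent is an index computed by `vertex`, but its word is the tail.
  path : ∀ w i → label i ≡ w → RootPath (parentOf ∘ label) i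
  path [] i eq = root (cong parentOf eq)
  path (x ∷ w) i eq = step (cong parentOf eq)
    (path w (vertex w) (label-vertex (tail-admissible (subst Admissible eq (label-admissible i)))))

  length-path : ∀ w i eq → length (pathVertices (path w i eq)) ≡ suc (length w)
  length-path [] i eq = refl
  length-path (x ∷ w) i eq = cong suc (length-path w _ _)

  ∈-path : ∀ w i eq {u} → u ∈ tails w → vertex u ∈ pathVertices (path w i eq)
  ∈-path [] i eq (here refl) = here (trans (cong vertex (sym eq)) (vertex-label i))
  ∈-path (x ∷ w) i eq (here refl) = here (trans (cong vertex (sym eq)) (vertex-label i))
  ∈-path (x ∷ w) i eq (there u∈) = there (∈-path w _ _ u∈)

  forest : RootedForest (length vertices)
  forest = record { parent = parentOf ∘ label ; rooted = λ i → path (label i) i refl }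

  universal-embeds : EmbedsInForest universal (suc h)
  universal-embeds = forest ,
    (λ {i} {j} ij → (λ i≡j → adj-irrefl universal i≡j ij) , swap (Sum.map ancestor ancestor ij)) ,
    depth≤⁺ forest λ i → ≤-trans (≤-reflexive (length-path (label i) i refl)) (s≤s (proj₂ (label-admissible i)))
    where
    ancestor : ∀ {i j} → Arc p (label i) (label j) → Ancestor forest j i
    ancestor {i} {j} (_ , b) = subst (_∈ _) (vertex-label j) (∈-path (label i) i refl (back⇒∈-tails b))

-- The universal graph belongs to the class

longest : ∀ {n} (f : Fin (suc n) → ℕ) → ∃[ i ] (∀ j → f j ≤ f i)
longest f = Extrema.argmax f zero (allFin _) ,
  λ j → All.lookup (Extrema.f[xs]≤f[argmax] {f = f} zero (allFin _)) (∈-allFin j)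

another : ∀ {n} (i : Fin (suc (suc n))) → ∃[ j ] i ≢ j
another zero = suc zero , λ ()
another (suc _) = zero , λ ()

-- All members of a clique are ancestors of its deepest member i, so they form a clique in the history of f i.
arcs-cliqueFree : ∀ {p s} → 2 ≤ p → (f : Fin p → Word s) →
  ¬ (∀ {i j} → i ≢ j → Arc p (f i) (f j) ⊎ Arc p (f j) (f i))
arcs-cliqueFree {suc (suc n)} (s≤s (s≤s z≤n)) f joined =
  let i , maximal = longest (length ∘ f) in absurd i maximal
  where
  absurd : ∀ i → ¬ (∀ j → length (f j) ≤ length (f i))
  -- As `p` is at least 2, some arc leaves `f i`; its first component denies the very clique that
  -- `f` forms.
  absurd i maximal = proj₁ (deepest-arc (proj₂ (another i))) (f , f∈ , λ j≢k → Sum.map proj₂ proj₂ (joined j≢k))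
    where
    deepest-arc : ∀ {j} → i ≢ j → Arc (suc (suc n)) (f i) (f j)
    deepest-arc {j} i≢j with joined i≢j
    ... | inj₁ arc = arc
    ... | inj₂ (_ , b) = contradiction (maximal j) (<⇒≱ (back⇒length< b))
    f∈ : ∀ j → f j ∈ tails (f i)
    f∈ j with i ≟ j
    ... | yes refl = here refl
    ... | no i≢j = back⇒∈-tails (proj₂ (deepest-arc i≢j))

module _ {p s h : ℕ} where

  open Universal p s h

  universal-completeFree : 2 ≤ p → CompleteFree p universal
  universal-completeFree 2≤p (f , _ , hom) = arcs-cliqueFree 2≤p (label ∘ f) hom

  universal∈class : 2 ≤ p → CompleteFreeOfTreedepthAtMost p (suc h) universal
  universal∈class 2≤p = universal-completeFree 2≤p , treedepthAtMost universal universal-embeds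

-- Coding the vertices of a graph in the class by words

module _ (G : Graph) {parent : Vertex G → Maybe (Vertex G)} where

  -- `pathVertices π` starts at the parent of `v`, so the bits list the nearest ancestor first, in
  -- step with the suffixes listed longest first.
  code : ∀ {v} → RootPath parent v → Word 1
  code (root _) = []
  code {v} (step _ π) = (map (does ∘ adj? G v) (pathVertices π) , zero) ∷ code π

  length-code : ∀ {v} (π : RootPath parent v) → suc (length (code π)) ≡ length (pathVertices π)
  length-code (root _) = refl
  length-code (step _ π) = cong suc (length-code π)

  code-admissible : ∀ {p h v} (π : RootPath parent v) →
    length (pathVertices π) ≤ suc h → Universal.Admissible p 1 h (code π)
  code-admissible (root _) _ = [] , z≤n
  code-admissible {p} {h} (step _ π) (s≤s short) =
    ≤-trans (≤-reflexive (length-map _ (pathVertices π))) short ∷ proj₁ (code-admissible {p} π (m≤n⇒m≤1+n short)) ,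
    ≤-trans (≤-reflexive (length-code π)) short

  -- The part of `π` that starts at `u` equals `ρ` by `RootPath-irrelevant`, so `code ρ` is the
  -- suffix at which the bit for `u` is read.
  code-selects : ∀ {v w u} (π : RootPath parent w) (ρ : RootPath parent u) →
    u ∈ pathVertices π → Adj G v u → Selects (map (does ∘ adj? G v) (pathVertices π)) (code π) (code ρ)
  code-selects {v} {u = u} π@(root _) ρ (here refl) vu with refl ← RootPath-irrelevant π ρ =
    here (dec-true (adj? G v u) vu)
  code-selects {v} {u = u} π@(step _ _) ρ (here refl) vu with refl ← RootPath-irrelevant π ρ =
    here (dec-true (adj? G v u) vu)
  code-selects (step _ π) ρ (there u∈) vu = there (code-selects π ρ u∈ vu)

  code-back : ∀ {v u} (π : RootPath parent v) (ρ : RootPath parent u) →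
    u ∈ pathVertices π → Adj G v u → Back (code π) (code ρ)
  code-back (root _) ρ (here refl) vu = contradiction vu (adj-irrefl G refl)
  code-back (step _ π) ρ (here refl) vu = contradiction vu (adj-irrefl G refl)
  code-back (step _ π) ρ (there u∈) vu = back (code-selects π ρ u∈ vu)

  -- The vertex at distance ℓ from the root (the last one if there is none).
  vertexAt : ∀ {v} → RootPath parent v → ℕ → Vertex G
  vertexAt {v} (root _) ℓ = v
  vertexAt {v} (step _ π) ℓ with ℓ ≤? length (code π)
  ... | yes _ = vertexAt π ℓ
  ... | no _ = v

  vertexAt-≤ : ∀ {v u ℓ} (e : parent v ≡ just u) (π : RootPath parent u) → ℓ ≤ length (code π) →
    vertexAt (step e π) ℓ ≡ vertexAt π ℓ
  vertexAt-≤ {ℓ = ℓ} e π ℓ≤ with ℓ ≤? length (code π)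
  ... | yes _ = refl
  ... | no ℓ≰ = contradiction ℓ≤ ℓ≰

  vertexAt-end : ∀ {v} (π : RootPath parent v) → vertexAt π (length (code π)) ≡ v
  vertexAt-end (root _) = refl
  vertexAt-end (step _ π) with suc (length (code π)) ≤? length (code π)
  ... | yes n<n = contradiction n<n 1+n≰n
  ... | no _ = refl

  -- The length of a suffix is the distance from the root of the vertex it encodes, which recovers
  -- that vertex; its bit was computed by `adj?`, so a true bit is an edge.
  selects⇒adj : ∀ {v w u} (π : RootPath parent w) →
    Selects (map (does ∘ adj? G v) (pathVertices π)) (code π) u → Adj G v (vertexAt π (length u))
  selects⇒adj {v} {w} (root _) (here b≡) = does⁻ (adj? G v w) b≡
  selects⇒adj {v} {w} π@(step _ _) (here b≡) = subst (Adj G v) (sym (vertexAt-end π)) (does⁻ (adj? G v w) b≡)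
  selects⇒adj {v} (step e π) (there sel) =
    subst (Adj G v) (sym (vertexAt-≤ e π (∈-tails⇒length≤ _ (selects⇒∈-tails sel)))) (selects⇒adj π sel)

  back⇒adj : ∀ {v w u} (π : RootPath parent v) → w ∈ tails (code π) → Back w u →
    Adj G (vertexAt π (length w)) (vertexAt π (length u))
  back⇒adj (root _) (here refl) ()
  back⇒adj π@(step e π′) (here refl) (back sel) = subst₂ (Adj G)
    (sym (vertexAt-end π)) (sym (vertexAt-≤ e π′ (∈-tails⇒length≤ _ (selects⇒∈-tails sel)))) (selects⇒adj π′ sel)
  back⇒adj (step e π) (there w∈) b = subst₂ (Adj G)
    (sym (vertexAt-≤ e π w≤)) (sym (vertexAt-≤ e π (≤-trans (<⇒≤ (back⇒length< b)) w≤))) (back⇒adj π w∈ b)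
    where w≤ = ∈-tails⇒length≤ _ w∈

  -- A clique of suffixes would be a complete subgraph of `G`; its vertices differ because adjacency
  -- is irreflexive. Hence codes keep all their back edges in `Arc`.
  code-cliqueFree : ∀ {p v} (π : RootPath parent v) → CompleteFree p G → ¬ Clique p (code π)
  code-cliqueFree {p} π free (f , f∈ , joined) = free (g , injective , hom)
    where
    g : Fin p → Vertex G
    g i = vertexAt π (length (f i))
    hom : ∀ {i j} → i ≢ j → Adj G (g i) (g j)
    hom {i} {j} i≢j = [ back⇒adj π (f∈ i) , adj-sym G ∘ back⇒adj π (f∈ j) ]′ (joined i≢j)
    injective : ∀ {i j} → g i ≡ g j → i ≡ j
    injective {i} {j} eq with i ≟ j
    ... | yes i≡j = i≡j
    ... | no i≢j = contradiction (hom i≢j) (adj-irrefl G eq)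

module _ {p h : ℕ} where

  open Universal p 1 h

  -- Sending a vertex to its code is a homomorphism: the ends of an edge are an ancestor and a
  -- descendant, and the code of the latter has an arc to that of the former. Proper colourings pull
  -- back along it.
  universal-colours : ∀ {n} → ProperlyColourable universal n →
    ∀ G → CompleteFreeOfTreedepthAtMost p (suc h) G → ProperlyColourable G n
  universal-colours (col , proper) G (free , t , ((F , emb , depth≡t) , _) , t≤k) =
    col ∘ vertex ∘ word , λ {u} {v} uv → proper ([ swap ∘ up (adj-sym G uv) , up uv ]′ (proj₂ (emb uv)))
    where
    word : Vertex G → Word 1
    word v = code G (rooted F v)
    admissible : ∀ v → Admissible (word v)
    admissible v = code-admissible G {p = p} (rooted F v)
      (≤-trans (vertexDepth≤depth F v) (≤-trans (≤-reflexive depth≡t) t≤k))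
    up : ∀ {v u} → Adj G v u → Ancestor F u v → Adj universal (vertex (word v)) (vertex (word u))
    up {v} {u} vu anc = arc⇒adj (admissible v) (admissible u)
      (code-cliqueFree G (rooted F v) free , code-back G (rooted F v) (rooted F u) anc vu)

-- Each of the at most h ancestors of a vertex rules out at most d of its copies.
module Greedy {p h d s n : ℕ} (enough : h * d ≤ s)
  (col : Colouring (Universal.universal p (suc s) h) n)
  (defect : HasDefect (Universal.universal p (suc s) h) col d) where

  private
    module U₁ = Universal p 1 h
    module U = Universal p (suc s) h

  colour : Word (suc s) → Fin n
  colour = col ∘ U.vertex

  Bad : List Bool → Word (suc s) → Word (suc s) → Fin (suc s) → Set
  Bad bs w u c = Arc p ((bs , c) ∷ w) u × colour ((bs , c) ∷ w) ≡ colour u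

  bad? : ∀ bs w u c → Dec (Bad bs w u c)
  bad? bs w u c = arc? p _ u ×-dec colour _ ≟ colour u

  Good : List Bool → Word (suc s) → Fin (suc s) → Set
  Good bs w c = All (λ u → ¬ Bad bs w u c) (tails w)

  good? : ∀ bs w → Dec (∃ (Good bs w))
  good? bs w = any? λ c → All.all? (λ u → ¬? (bad? bs w u c)) (tails w)

  suffix-admissible : ∀ w {u} → U.Admissible w → u ∈ tails w → U.Admissible u
  suffix-admissible w w✓ (here refl) = w✓
  suffix-admissible (_ ∷ w) w✓ (there u∈) = suffix-admissible w (U.tail-admissible w✓) u∈

  -- Bad copies are distinct neighbours of `u` in the colour of `u`, so `defect⇒few` bounds their
  -- number.
  few-bad : ∀ {bs w} → (∀ c → U.Admissible ((bs , c) ∷ w)) → ∀ {u} → u ∈ tails w →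
    ∀ {cs} → Unique cs → All (Bad bs w u) cs → length cs ≤ d
  few-bad {bs} {w} w✓ {u} u∈ {cs} unique bad = ≤-trans (≤-reflexive (sym (length-map x cs)))
    (defect⇒few U.universal col defect (Unique.map⁺ x-injective unique) (All.map⁺ (All.map
      (λ {c} (arc , same) →
        adj-sym U.universal (U.arc⇒adj (w✓ c) (suffix-admissible w (U.tail-admissible (w✓ c)) u∈) arc) , same)
      bad)))
    where
    x : Fin (suc s) → Vertex U.universal
    x c = U.vertex ((bs , c) ∷ w)
    x-injective : ∀ {c c′} → x c ≡ x c′ → c ≡ c′
    x-injective {c} {c′} eq = Product.,-injectiveʳ (∷-injectiveˡ
      (trans (sym (U.label-vertex (w✓ c))) (trans (cong U.label eq) (U.label-vertex (w✓ c′)))))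

  exists-good : ∀ {bs w} → (∀ c → U.Admissible ((bs , c) ∷ w)) → ∃ (Good bs w)
  exists-good {bs} {w} w✓ =
    let c , _ , good = avoid (bad? bs w) (tails w) (few-bad w✓) (Unique.allFin⁺ (suc s)) (begin-strict
          length (tails w) * d       ≡⟨ cong (_* d) (length-tails w) ⟩
          -- The suffixes of `w`, including the empty one, are as many as the letters of the
          -- extended word, which is admissible.
          suc (length w) * d         ≤⟨ *-monoˡ-≤ d (proj₂ (w✓ zero)) ⟩
          h * d                      ≤⟨ enough ⟩
          s                          <⟨ ≤-refl ⟩
          suc s                      ≡⟨ length-tabulate {n = suc s} id ⟨
          length (allFin (suc s))    ∎)
    in c , good
    where open ≤-Reasoning

  abstract

    choose : List Bool → Word (suc s) → Fin (suc s)
    choose bs w with good? bs w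
    ... | yes (c , _) = c
    -- A default value; `exists-good` rules this case out for admissible words.
    ... | no _ = zero

    choose-good : ∀ {bs w} → ∃ (Good bs w) → Good bs w (choose bs w)
    choose-good {bs} {w} good with good? bs w
    ... | yes (_ , good) = good
    ... | no none = contradiction good none

  copy : Word 1 → Word (suc s)
  copy = recopy choose

  copy-admissible : ∀ w → U₁.Admissible w → U.Admissible (copy w)
  copy-admissible [] _ = [] , z≤n
  copy-admissible (_ ∷ w) w✓@(bs≤h ∷ _ , len) =
    bs≤h ∷ proj₁ ih , ≤-trans (≤-reflexive (cong suc (length-recopy w))) len
    where
    ih = copy-admissible w (U₁.tail-admissible w✓)
    length-recopy : ∀ w → length (copy w) ≡ length w
    length-recopy [] = refl
    length-recopy (_ ∷ w) = cong suc (length-recopy w)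

  -- The first letter of `copy w` was chosen good against every suffix of the copied tail, and
  -- `copy u` is one of them; equal colours would make that choice bad.
  proper : ∀ {w u} → U₁.Admissible w → Arc p w u → colour (copy w) ≢ colour (copy u)
  proper {x ∷ w} {u} w✓@(bs≤h ∷ _ , _) arc@(_ , back sel) same =
    All.lookup (choose-good (exists-good λ _ →
        bs≤h ∷ proj₁ (copy-admissible w (U₁.tail-admissible w✓)) , proj₂ (copy-admissible (x ∷ w) w✓)))
      (recopy-tails choose w (selects⇒∈-tails sel))
      (recopy-arc choose arc , same)

  properlyColourable : ProperlyColourable U₁.universal n
  properlyColourable = colour ∘ copy ∘ U₁.label , λ {u} {v} →
    [ proper (U₁.label-admissible u) , (λ arc → ≢-sym (proper (U₁.label-admissible v) arc)) ]′

-- Equality of the three chromatic numbers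

module _ {p h : ℕ} (3≤p : 3 ≤ p) {n : ℕ} (χ : IsChromaticNumberOf (Universal.universal p 1 h) n) where

  private
    𝒢 : Graph → Set
    𝒢 = CompleteFreeOfTreedepthAtMost p (suc h)

  colours : ∀ G → 𝒢 G → ProperlyColourable G n
  colours = universal-colours {p} {h} {n} (proj₁ χ)

  defective≥n : ∀ j → ∃[ d ] (∀ G → 𝒢 G → Σ[ col ∈ Colouring G j ] HasDefect G col d) → n ≤ j
  defective≥n j (d , colour) =
    -- At most `h` ancestors spoil `d` copies each, so `suc (h * d)` copies leave one to choose.
    proj₂ χ j (Greedy.properlyColourable {p} {h} {d} {h * d} {j} ≤-refl (proj₁ coloured) (proj₂ coloured))
    where
    coloured : Σ[ col ∈ Colouring (Universal.universal p (suc (h * d)) h) j ]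
                 HasDefect (Universal.universal p (suc (h * d)) h) col d
    coloured = colour (Universal.universal p (suc (h * d)) h) (universal∈class {p} {suc (h * d)} {h} (<⇒≤ 3≤p))

  isDefectiveChromaticNumber : IsDefectiveChromaticNumber 𝒢 n
  isDefectiveChromaticNumber =
    (0 , λ G G∈ → let col , proper = colours G G∈ in col , proper⇒defect0 G col proper) , defective≥n

  isClusteredChromaticNumber : IsClusteredChromaticNumber 𝒢 n
  isClusteredChromaticNumber =
    (1 , λ G G∈ → let col , proper = colours G G∈ in col , proper⇒clustering1 G col proper) ,
    -- Clustering `c` implies defect `c`, so the lower bound for defective colouring carries over.
    λ j (c , clustered) → defective≥n j (c , λ G G∈ →
      let col , clustering = clustered G G∈ in col , clustering⇒defect G col clustering)

  isChromaticNumber : IsChromaticNumber 𝒢 n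
  isChromaticNumber =
    -- The maximum is attained by the universal graph with single copies.
    (Universal.universal p 1 h , universal∈class {p} {1} {h} (<⇒≤ 3≤p) , χ) ,
    λ j (G , G∈ , _ , minimal) → minimal n (colours G G∈)

theorem9 : ∀ (p k : ℕ) → 3 ≤ p → 1 ≤ k →
    ∃[ n ] (IsDefectiveChromaticNumber (CompleteFreeOfTreedepthAtMost p k) n
    × IsClusteredChromaticNumber (CompleteFreeOfTreedepthAtMost p k) n
    × IsChromaticNumber (CompleteFreeOfTreedepthAtMost p k) n)
theorem9 p (suc h) 3≤p (s≤s _) =
  let n , χ = hasChromaticNumber (Universal.universal p 1 h)
  in n , isDefectiveChromaticNumber 3≤p χ , isClusteredChromaticNumber 3≤p χ , isChromaticNumber 3≤p χ
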